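{- Let $G$ be a finite simple graph that is $\{2K_2, K_5-e\}$-free with $\omega(G)\geq 4$. Then $\chi(G)\leq 6$ if $\omega(G)=4$, and $\chi(G)\leq \omega(G)$ if $\omega(G)\geq 5$.
   Context: $\chi(G)$ is the chromatic number and $\omega(G)$ the clique number of $G$. $2K_2$ is the disjoint union of two edges; $K_5-e$ is the complete graph on five vertices with one edge removed. A graph is $\mathcal{F}$-free if it has no induced subgraph isomorphic to a member of $\mathcal{F}$. -}

module Defs where

open import Data.Nat using (ℕ; zero; suc; _≤_)
open import Data.Nat.Base using (_≡ᵇ_)
open import Data.Fin using (Fin; toℕ)
open import Data.Fin.Properties using (all?)
open import Data.Bool using (Bool; true; false; _∧_; _∨_; not)
open import Data.Bool.Properties using () renaming (_≟_ to _≟ᵇ_)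
open import Data.Product using (Σ; _×_)
open import Data.Unit using (tt)
open import Function.Definitions using (Injective)
open import Relation.Nullary using (¬_)
open import Relation.Nullary.Decidable using (toWitness)
open import Relation.Binary.PropositionalEquality using (_≡_; _≢_)

record Graph : Set where
  field
    n      : ℕ
    adj    : Fin n → Fin n → Bool
    sym    : ∀ u v → adj u v ≡ adj v u
    irrefl : ∀ v → adj v v ≡ false

open Graph public

Adj : (G : Graph) → Fin (n G) → Fin (n G) → Set
Adj G u v = adj G u v ≡ true

InducedSubgraph : Graph → Graph → Set
InducedSubgraph H G =
  Σ (Fin (n H) → Fin (n G)) λ f →
    Injective _≡_ _≡_ f × (∀ u v → adj H u v ≡ adj G (f u) (f v))

Free : Graph → Graph → Set
Free H G = ¬ InducedSubgraph H G

HasClique : Graph → ℕ → Set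
HasClique G k =
  Σ (Fin k → Fin (n G)) λ f →
    Injective _≡_ _≡_ f × (∀ i j → i ≢ j → Adj G (f i) (f j))

CliqueNumber : Graph → ℕ → Set
CliqueNumber G k = HasClique G k × ¬ HasClique G (suc k)

Colorable : Graph → ℕ → Set
Colorable G c =
  Σ (Fin (n G) → Fin c) λ col → ∀ u v → Adj G u v → col u ≢ col v

symAdj : (m : ℕ) → (ℕ → ℕ → Bool) → Fin m → Fin m → Bool
symAdj m e u v = not (toℕ u ≡ᵇ toℕ v) ∧ (e (toℕ u) (toℕ v) ∨ e (toℕ v) (toℕ u))

e2K₂ : ℕ → ℕ → Bool
e2K₂ 0 1 = true
e2K₂ 2 3 = true
e2K₂ _ _ = false

2K₂ : Graph
2K₂ = record
  { n = 4
  ; adj = symAdj 4 e2K₂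
  ; sym = toWitness {a? = all? λ u → all? λ v → symAdj 4 e2K₂ u v ≟ᵇ symAdj 4 e2K₂ v u} tt
  ; irrefl = toWitness {a? = all? λ v → symAdj 4 e2K₂ v v ≟ᵇ false} tt
  }

eK₅-e : ℕ → ℕ → Bool
eK₅-e 0 1 = false
eK₅-e 1 0 = false
eK₅-e _ _ = true

K₅-e : Graph
K₅-e = record
  { n = 5
  ; adj = symAdj 5 eK₅-e
  ; sym = toWitness {a? = all? λ u → all? λ v → symAdj 5 eK₅-e u v ≟ᵇ symAdj 5 eK₅-e v u} tt
  ; irrefl = toWitness {a? = all? λ v → symAdj 5 eK₅-e v v ≟ᵇ false} tt
  }

{-# OPTIONS --safe #-}
-- In a 2K₂-free graph every edge s t yields an independent set: s together with
-- all vertices adjacent to neither s nor t.  Let K be a maximum clique.  A vertex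
-- outside K misses some vertex of K, and would induce a K₅-e with it and any
-- three neighbours in K; so it has at most two neighbours in K.  Hence, given a
-- digraph D on K whose vertex covers all have at least three elements, every
-- vertex outside K misses both ends of some arc of D.  If moreover every vertex
-- of K is the tail of an arc, the independent sets of the arcs of D cover G.  For
-- ω(G) = 4 orient the six edges of K; for ω(G) ≥ 5 take a directed triangle, a
-- disjoint edge, and one arbitrary arc out of each vertex that is not yet a tail.
module Submission where

open import Defs
open import Data.Bool using (true)
open import Data.Bool.Properties using (¬-not) renaming (_≟_ to _≟ᵇ_)
open import Data.Fin using (Fin; zero; suc; _<_)
open import Data.Fin.Patterns using (0F; 1F; 2F; 3F; 4F; 5F)
open import Data.Fin.Properties using (_≟_; <-cmp; <⇒≢; all?; any?; ¬∀⟶∃¬)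
open import Data.Nat using (ℕ; suc; _+_; _≤_; s<s; z<s)
open import Data.Nat.Properties using (m≤n⇒∃[o]m+o≡n)
open import Data.Product using (Σ; ∃; _×_; _,_; proj₁; proj₂; curry; map₂)
open import Data.Sum using (_⊎_; inj₁; inj₂)
open import Data.Unit using (tt)
open import Data.Vec using (Vec; []; _∷_; lookup)
open import Data.Vec.Functional using () renaming (_∷_ to _∷ᶠ_)
open import Data.Vec.Relation.Unary.All using (All; []; _∷_)
open import Data.Vec.Relation.Unary.All.Properties using (lookup⁺)
open import Data.Vec.Relation.Unary.AllPairs using (allPairs?)
open import Data.Vec.Relation.Unary.Unique.Propositional using (Unique)
open import Data.Vec.Relation.Unary.Unique.Propositional.Properties
  using (lookup-injective)
open import Function using (id; _∘_)
open import Function.Definitions using (Injective)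
open import Level using (Level; 0ℓ)
open import Relation.Binary using (tri<; tri≈; tri>)
open import Relation.Binary.PropositionalEquality
  using (_≡_; _≢_; refl; trans; cong; subst; module ≡-Reasoning)
  renaming (sym to ≡-sym)
open import Relation.Nullary using (¬_; Dec; yes; no; ¬?; contradiction)
open import Relation.Nullary.Decidable using (True; toWitness; _→-dec_; _⊎-dec_)
open import Relation.Unary using (Pred; Decidable)

private
  variable
    a : Level
    A B C : Set a
    k m r : ℕ

∷-injective : {x : A} {f : Fin r → A} → (∀ i → x ≢ f i) →
              Injective _≡_ _≡_ f → Injective _≡_ _≡_ (x ∷ᶠ f)
∷-injective x∉f f-inj {zero}  {zero}  _  = refl
∷-injective x∉f f-inj {zero}  {suc j} eq = contradiction eq (x∉f j)
∷-injective x∉f f-inj {suc i} {zero}  eq = contradiction (≡-sym eq) (x∉f i)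
∷-injective x∉f f-inj {suc i} {suc j} eq = cong suc (f-inj eq)

AtLeast : {A : Set a} → ℕ → Pred A 0ℓ → Set a
AtLeast {A = A} r P = Σ (Vec A r) λ xs → Unique xs × All P xs

unique? : (xs : Vec (Fin k) r) → Dec (Unique xs)
unique? = allPairs? λ i j → ¬? (i ≟ j)

two-of-three : A ⊎ B → B ⊎ C → C ⊎ A → (A × B) ⊎ (B × C) ⊎ (C × A)
two-of-three (inj₁ a) (inj₁ b) _        = inj₁ (a , b)
two-of-three (inj₁ a) (inj₂ c) _        = inj₂ (inj₂ (c , a))
two-of-three (inj₂ b) _        (inj₁ c) = inj₂ (inj₁ (b , c))
two-of-three (inj₂ b) _        (inj₂ a) = inj₁ (a , b)

disjoint-edge⇒atLeast-suc : {P : Pred (Fin k) 0ℓ} {xs : Vec (Fin k) r} {s t : Fin k}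
  {_ : True (unique? (s ∷ xs))} {_ : True (unique? (t ∷ xs))} →
  All P xs → P s ⊎ P t → AtLeast (suc r) P
disjoint-edge⇒atLeast-suc {xs = xs} {s} {_} {sxs} pxs (inj₁ ps) =
  s ∷ xs , toWitness sxs , ps ∷ pxs
disjoint-edge⇒atLeast-suc {xs = xs} {_} {t} {_} {txs} pxs (inj₂ pt) =
  t ∷ xs , toWitness txs , pt ∷ pxs

record ArcSystem (k m : ℕ) : Set₁ where
  field
    tail head : Fin m → Fin k

  Covers : Pred (Fin k) 0ℓ → Set
  Covers P = ∀ p → P (tail p) ⊎ P (head p)

  field
    loopless : ∀ p → tail p ≢ head p
    out-arc  : ∀ i → ∃ λ p → tail p ≡ i
    cover≥3  : ∀ {P} → Covers P → AtLeast 3 P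

  uncovered-arc : {P : Pred (Fin k) 0ℓ} → Decidable P → ¬ AtLeast 3 P →
                  ∃ λ p → ¬ P (tail p) × ¬ P (head p)
  uncovered-arc {P} P? ¬3≤P =
    let p , ¬covered = ¬∀⟶∃¬ m _ (λ p → P? (tail p) ⊎-dec P? (head p)) (¬3≤P ∘ cover≥3)
    in p , ¬covered ∘ inj₁ , ¬covered ∘ inj₂

open ArcSystem

K₄-arcs : ArcSystem 4 6
K₄-arcs .tail     = lookup (0F ∷ 1F ∷ 2F ∷ 2F ∷ 3F ∷ 1F ∷ [])
K₄-arcs .head     = lookup (1F ∷ 2F ∷ 0F ∷ 3F ∷ 0F ∷ 3F ∷ [])
K₄-arcs .loopless = λ { 0F () ; 1F () ; 2F () ; 3F () ; 4F () ; 5F () }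
K₄-arcs .out-arc  = λ { 0F → 0F , refl ; 1F → 1F , refl ; 2F → 2F , refl ; 3F → 4F , refl }
K₄-arcs .cover≥3 c with two-of-three (c 0F) (c 1F) (c 2F)
... | inj₁ (p₀ , p₁)        = disjoint-edge⇒atLeast-suc (p₀ ∷ p₁ ∷ []) (c 3F)
... | inj₂ (inj₁ (p₁ , p₂)) = disjoint-edge⇒atLeast-suc (p₁ ∷ p₂ ∷ []) (c 4F)
... | inj₂ (inj₂ (p₂ , p₀)) = disjoint-edge⇒atLeast-suc (p₂ ∷ p₀ ∷ []) (c 5F)

triangle-and-edge-arcs : ∀ k → ArcSystem (5 + k) (5 + k)
triangle-and-edge-arcs k .tail = id
triangle-and-edge-arcs k .head = λ
  { 0F                        → 1F
  ; 1F                        → 2F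
  ; 2F                        → 0F
  ; 3F                        → 4F
  ; (suc (suc (suc (suc _)))) → 0F
  }
triangle-and-edge-arcs k .loopless =
  λ { 0F () ; 1F () ; 2F () ; 3F () ; (suc (suc (suc (suc _)))) () }
triangle-and-edge-arcs k .out-arc i = i , refl
triangle-and-edge-arcs k .cover≥3 c with two-of-three (c 0F) (c 1F) (c 2F)
... | inj₁ (p₀ , p₁)        = disjoint-edge⇒atLeast-suc (p₀ ∷ p₁ ∷ []) (c 3F)
... | inj₂ (inj₁ (p₁ , p₂)) = disjoint-edge⇒atLeast-suc (p₁ ∷ p₂ ∷ []) (c 3F)
... | inj₂ (inj₂ (p₂ , p₀)) = disjoint-edge⇒atLeast-suc (p₂ ∷ p₀ ∷ []) (c 3F)

Preserves : (H G : Graph) → (Fin (n H) → Fin (n G)) → Set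
Preserves H G g = ∀ u v → adj H u v ≡ adj G (g u) (g v)

TwinFree : Graph → Set
TwinFree H = ∀ u v → (∀ w → adj H u w ≡ adj H v w) → u ≡ v

module _ (H G : Graph) {g : Fin (n H) → Fin (n G)} where

  preserves-<⇒preserves : (∀ u v → u < v → adj H u v ≡ adj G (g u) (g v)) → Preserves H G g
  preserves-<⇒preserves pres u v with <-cmp u v
  ... | tri< u<v _    _   = pres u v u<v
  ... | tri≈ _   refl _   = trans (irrefl H u) (≡-sym (irrefl G (g u)))
  ... | tri> _   _    v<u = trans (sym H u v) (trans (pres v u v<u) (sym G (g v) (g u)))

  twinFree⇒injective : TwinFree H → Preserves H G g → Injective _≡_ _≡_ g
  twinFree⇒injective twinFree pres {u} {v} gu≡gv = twinFree u v λ w → begin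
    adj H u w          ≡⟨ pres u w ⟩
    adj G (g u) (g w)  ≡⟨ cong (λ x → adj G x (g w)) gu≡gv ⟩
    adj G (g v) (g w)  ≡⟨ pres v w ⟨
    adj H v w          ∎
    where open ≡-Reasoning

2K₂-twinFree : TwinFree 2K₂
2K₂-twinFree = toWitness {a? = all? λ u → all? λ v →
  (all? λ w → adj 2K₂ u w ≟ᵇ adj 2K₂ v w) →-dec (u ≟ v)} tt

K₅-e-minus-0F-complete : ∀ u v → u ≢ v → Adj K₅-e (suc u) (suc v)
K₅-e-minus-0F-complete = toWitness {a? = all? λ u → all? λ v →
  ¬? (u ≟ v) →-dec (adj K₅-e (suc u) (suc v) ≟ᵇ true)} tt

module _ (G : Graph) where

  private
    V : Set
    V = Fin (n G)

  Adj-sym : ∀ {u v} → Adj G u v → Adj G v u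
  Adj-sym {u} {v} = trans (sym G v u)

  Adj-irrefl : ∀ {u} → ¬ Adj G u u
  Adj-irrefl {u} uu = contradiction (trans (≡-sym uu) (irrefl G u)) λ ()

  Adj⇒≢ : ∀ {u v} → Adj G u v → u ≢ v
  Adj⇒≢ uv refl = Adj-irrefl uv

  adj? : ∀ u v → Dec (Adj G u v)
  adj? u v = adj G u v ≟ᵇ true

  disjoint-edges⇒2K₂ : ∀ {a b c d} → Adj G a b → Adj G c d →
    ¬ Adj G a c → ¬ Adj G a d → ¬ Adj G b c → ¬ Adj G b d → InducedSubgraph 2K₂ G
  disjoint-edges⇒2K₂ {a} {b} {c} {d} ab cd ¬ac ¬ad ¬bc ¬bd =
    g , twinFree⇒injective 2K₂ G 2K₂-twinFree preserves , preserves
    where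
    g : Fin 4 → V
    g = lookup (a ∷ b ∷ c ∷ d ∷ [])

    -- Matching on u < v lets the coverage checker discard the pairs with u ≥ v.
    preserves-< : ∀ u v → u < v → adj 2K₂ u v ≡ adj G (g u) (g v)
    preserves-< 0F 1F _               = ≡-sym ab
    preserves-< 0F 2F _               = ≡-sym (¬-not ¬ac)
    preserves-< 0F 3F _               = ≡-sym (¬-not ¬ad)
    preserves-< 1F 2F (s<s _)         = ≡-sym (¬-not ¬bc)
    preserves-< 1F 3F (s<s _)         = ≡-sym (¬-not ¬bd)
    preserves-< 2F 3F (s<s (s<s z<s)) = ≡-sym cd

    preserves : Preserves 2K₂ G g
    preserves = preserves-<⇒preserves 2K₂ G preserves-<

  clique-∷ : ((f , _) : HasClique G k) {x : V} → (∀ i → Adj G x (f i)) → HasClique G (suc k)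
  clique-∷ {k} (f , f-inj , f-adj) {x} xf =
    x ∷ᶠ f , ∷-injective (Adj⇒≢ ∘ xf) f-inj , pairwise
    where
    pairwise : ∀ i j → i ≢ j → Adj G ((x ∷ᶠ f) i) ((x ∷ᶠ f) j)
    pairwise zero    zero    0≢0 = contradiction refl 0≢0
    pairwise zero    (suc j) _   = xf j
    pairwise (suc i) zero    _   = Adj-sym (xf i)
    pairwise (suc i) (suc j) i≢j = f-adj i j (i≢j ∘ cong suc)

  subclique : HasClique G k → {h : Fin r → Fin k} → Injective _≡_ _≡_ h → HasClique G r
  subclique (f , f-inj , f-adj) {h} h-inj =
    f ∘ h , h-inj ∘ f-inj , λ i j i≢j → f-adj (h i) (h j) (i≢j ∘ h-inj)

  triangle-with-two-apexes⇒K₅-e : ((t , _) : HasClique G 3) → ∀ {x y} → x ≢ y → ¬ Adj G x y →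
    (∀ i → Adj G x (t i)) → (∀ i → Adj G y (t i)) → InducedSubgraph K₅-e G
  triangle-with-two-apexes⇒K₅-e T@(t , _) {x} {y} x≢y ¬xy xt yt =
    x ∷ᶠ f , ∷-injective x∉f (proj₁ (proj₂ yT)) , preserves-<⇒preserves K₅-e G preserves-<
    where
    yT : HasClique G 4
    yT = clique-∷ T yt

    f : Fin 4 → V
    f = proj₁ yT

    x∉f : ∀ i → x ≢ f i
    x∉f zero    = x≢y
    x∉f (suc i) = Adj⇒≢ (xt i)

    preserves-< : ∀ u v → u < v → adj K₅-e u v ≡ adj G ((x ∷ᶠ f) u) ((x ∷ᶠ f) v)
    preserves-< zero    1F            _         = ≡-sym (¬-not ¬xy)
    preserves-< zero    (suc (suc i)) _         = ≡-sym (xt i)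
    preserves-< (suc u) (suc v)       (s<s u<v) =
      trans (K₅-e-minus-0F-complete u v u≢v) (≡-sym (proj₂ (proj₂ yT) u v u≢v))
      where
      u≢v : u ≢ v
      u≢v = <⇒≢ u<v

  maximum-clique⇒nonneighbour : (((f , _) , _) : CliqueNumber G k) →
    ∀ x → ∃ λ i → ¬ Adj G x (f i)
  maximum-clique⇒nonneighbour {k} (K@(f , _) , maximum) x =
    ¬∀⟶∃¬ k _ (λ i → adj? x (f i)) (maximum ∘ clique-∷ K)

  outside⇒at-most-two-neighbours : Free K₅-e G → (((f , _) , _) : CliqueNumber G k) →
    ∀ {x} → (∀ i → x ≢ f i) → ¬ AtLeast 3 (λ i → Adj G x (f i))
  outside⇒at-most-two-neighbours K₅-e-free ω@(K@(f , _ , f-adj) , _) {x} x∉f (ys , unique , xys)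
    with j , ¬xj ← maximum-clique⇒nonneighbour ω x =
    K₅-e-free (triangle-with-two-apexes⇒K₅-e (subclique K (lookup-injective unique _ _))
      (x∉f j) ¬xj xy (λ i → f-adj j (lookup ys i) (j≢y i)))
    where
    xy : ∀ i → Adj G x (f (lookup ys i))
    xy = lookup⁺ xys

    j≢y : ∀ i → j ≢ lookup ys i
    j≢y i j≡y = ¬xj (subst (λ l → Adj G x (f l)) (≡-sym j≡y) (xy i))

  EdgeClass : V → V → Pred V 0ℓ
  EdgeClass s t x = x ≡ s ⊎ (¬ Adj G x s × ¬ Adj G x t)

  edgeClass-independent : Free 2K₂ G → ∀ {s t x y} → Adj G s t →
    EdgeClass s t x → EdgeClass s t y → ¬ Adj G x y
  edgeClass-independent _ _ (inj₁ refl) (inj₁ refl)      ss = Adj-irrefl ss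
  edgeClass-independent _ _ (inj₁ refl) (inj₂ (¬ys , _)) sy = ¬ys (Adj-sym sy)
  edgeClass-independent _ _ (inj₂ (¬xs , _)) (inj₁ refl) xs = ¬xs xs
  edgeClass-independent 2K₂-free st (inj₂ (¬xs , ¬xt)) (inj₂ (¬ys , ¬yt)) xy =
    2K₂-free (disjoint-edges⇒2K₂ xy st ¬xs ¬xt ¬ys ¬yt)

  independent-cover⇒colorable : {C : Fin m → Pred V 0ℓ} →
    (∀ p {x y} → C p x → C p y → ¬ Adj G x y) → (∀ x → ∃ λ p → C p x) → Colorable G m
  independent-cover⇒colorable {m} {C} independent cover =
    colour , λ x y xy same →
      independent (colour y) (subst (λ p → C p x) same (inClass x)) (inClass y) xy
    where
    colour : V → Fin m
    colour = proj₁ ∘ cover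

    inClass : ∀ x → C (colour x) x
    inClass = proj₂ ∘ cover

  arcSystem⇒colorable : ArcSystem k m → CliqueNumber G k →
    Free 2K₂ G → Free K₅-e G → Colorable G m
  arcSystem⇒colorable D ω@((f , _ , f-adj) , _) 2K₂-free K₅-e-free =
    independent-cover⇒colorable
      (λ p → edgeClass-independent 2K₂-free (f-adj (tail D p) (head D p) (loopless D p)))
      arcClass
    where
    arcClass : ∀ x → ∃ λ p → EdgeClass (f (tail D p)) (f (head D p)) x
    arcClass x with any? (λ i → x ≟ f i)
    ... | yes (i , x≡fi) with p , refl ← out-arc D i = p , inj₁ x≡fi
    ... | no x∉f = map₂ inj₂ (uncovered-arc D (λ i → adj? x (f i))
                    (outside⇒at-most-two-neighbours K₅-e-free ω (curry x∉f)))

theorem2p8 : (G : Graph) → (k : ℕ) → CliqueNumber G k → 4 ≤ k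
    → Free 2K₂ G → Free K₅-e G
    → (k ≡ 4 → Colorable G 6) × (5 ≤ k → Colorable G k)
theorem2p8 G k ω≡k _ 2K₂-free K₅-e-free = colorable-ω≡4 , colorable-ω≥5
  where
  colorable-ω≡4 : k ≡ 4 → Colorable G 6
  colorable-ω≡4 refl = arcSystem⇒colorable G K₄-arcs ω≡k 2K₂-free K₅-e-free

  colorable-ω≥5 : 5 ≤ k → Colorable G k
  colorable-ω≥5 5≤k with l , refl ← m≤n⇒∃[o]m+o≡n 5≤k =
    arcSystem⇒colorable G (triangle-and-edge-arcs l) ω≡k 2K₂-free K₅-e-free
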